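{- For every standard formula $\alpha$ and all formulas $\phi,\psi$ of the team language, the formulas $\alpha\vee\alpha\to\alpha$ and $(\phi\to\alpha)\to((\psi\to\alpha)\to(\phi\vee\psi\to\alpha))$ are valid on every distributive general intuitionistic team Kripke frame.
   Context: **Language.** Fix a set $\mathsf{Prop}$ of propositional variables. Formulas of the team language are $\phi::=p\mid\bot\mid\phi\wedge\phi\mid\phi\vee\phi\mid\phi\veebar\phi\mid\phi\to\phi$; $\vee$ is the local and $\veebar$ the global disjunction; both bind more strongly than $\to$. Formulas without $\veebar$ are standard. **Frames.** For a nonempty set $W$ with a partial order $R$, teams are sets $t\subseteq W$; $R[t]=\{v\mid\exists w\in t:\ wRv\}$; and $tR^\circ s$ iff $\forall w\in t\,\exists v\in s\,(wRv)$ and $\forall v\in s\,\exists w\in t\,(wRv)$. A general intuitionistic team Kripke frame is $(W,R,\succcurlyeq,\Cup)$ where $W\neq\varnothing$, $R$ is a partial order on $W$, $\Cup$ is a binary operation on $\wp(W)$ such that $(\wp(W),\Cup,\varnothing)$ is a bounded join-semilattice ($\Cup$ associative, commutative, idempotent, $\varnothing\Cup t=t$), $\preccurlyeq$ is the induced partial order ($t\preccurlyeq s$ iff $t\Cup s=s$) with converse $\succcurlyeq$, and for all $t,s,s'\subseteq W$: - (a) if $tR^\circ s$ and $s\succcurlyeq s'$, then there is $t'\subseteq W$ with $t\succcurlyeq t'$ and $t'R^\circ s'$; - (b) $t\succcurlyeq\circ R^\circ s$ implies $R[t]\succcurlyeq s$, where $t\succcurlyeq\circ R^\circ s$ means there is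 $r\subseteq W$ with $t\succcurlyeq r$ and $rR^\circ s$; - (c) $R[t]\Cup R[s]=R[t\Cup s]$. The frame is distributive if for all $t,r,s\subseteq W$, $t\preccurlyeq r\Cup s$ implies that there are $r',s'\subseteq W$ with $r'\preccurlyeq r$, $s'\preccurlyeq s$ and $t=r'\Cup s'$. A model on the frame adds a valuation $V:\mathsf{Prop}\to\wp(W)$ persistent w.r.t. $R$ ($w\in V(p)$, $wRv$ imply $v\in V(p)$). **Generalized team semantics:** - $\mathfrak{M},t\models p$ iff $t\preccurlyeq V(p)$; - $\mathfrak{M},t\models\bot$ iff $t=\varnothing$; - $\mathfrak{M},t\models\phi\wedge\psi$ iff $\mathfrak{M},t\models\phi$ and $\mathfrak{M},t\models\psi$; - $\mathfrak{M},t\models\phi\vee\psi$ iff there are $s,r\subseteq W$ with $t\preccurlyeq s\Cup r$, $\mathfrak{M},s\models\phi$ and $\mathfrak{M},r\models\psi$; - $\mathfrak{M},t\models\phi\veebar\psi$ iff $\mathfrak{M},t\models\phi$ or $\mathfrak{M},t\models\psi$; - $\mathfrak{M},t\models\phi\to\psi$ iff for all $s\subseteq W$ with $t\succcurlyeq\circ R^\circ s$, $\mathfrak{M},s\models\phi$ implies $\mathfrak{M},s\models\psi$. A formula is valid on a frame if it holds at all teams in all models on the frame. -}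

module Defs where

open import Level using (Level; _⊔_; Lift) renaming (suc to lsuc)
open import Data.Product.Base using (∃-syntax; _×_)
open import Data.Sum.Base using (_⊎_)
open import Relation.Binary.Core using (Rel)
open import Relation.Binary.Structures using (IsPartialOrder)
open import Relation.Binary.PropositionalEquality.Core using (_≡_)
open import Relation.Unary using (Pred; _∈_; _≐_)
open import Relation.Unary.Polymorphic using (∅)
open import Algebra.Core using (Op₂)
open import Algebra.Lattice.Structures using (IsBoundedJoinSemilattice)

infix  9 _[_]
infixr 7 _∧_
infixr 6 _∨_ _⊻_
infixr 5 _⇒_

-- _∨_ is the local and _⊻_ the global disjunction.
data Formula {a : Level} (Var : Set a) : Set a where
  var             : Var → Formula Var
  ⊥               : Formula Var
  _∧_ _∨_ _⊻_ _⇒_ : Formula Var → Formula Var → Formula Var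

data Standard {a : Level} {Var : Set a} : Formula Var → Set a where
  var : ∀ p → Standard (var p)
  ⊥   : Standard ⊥
  _∧_ : ∀ {φ ψ} → Standard φ → Standard ψ → Standard (φ ∧ ψ)
  _∨_ : ∀ {φ ψ} → Standard φ → Standard ψ → Standard (φ ∨ ψ)
  _⇒_ : ∀ {φ ψ} → Standard φ → Standard ψ → Standard (φ ⇒ ψ)

-- The powerset of W is Pred W ℓ, with W and R at the same level ℓ so that it
-- is closed under R [_]. Teams are compared by extensional equality _≐_.
Team : {ℓ : Level} → Set ℓ → Set (lsuc ℓ)
Team {ℓ} W = Pred W ℓ

_[_] : {ℓ : Level} {W : Set ℓ} → Rel W ℓ → Team W → Team W
(R [ t ]) v = ∃[ w ] (w ∈ t × R w v)

Lifting : {ℓ : Level} {W : Set ℓ} → Rel W ℓ → Rel (Team W) ℓ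
Lifting R t s =
  (∀ w → w ∈ t → ∃[ v ] (v ∈ s × R w v)) ×
  (∀ v → v ∈ s → ∃[ w ] (w ∈ t × R w v))

record Frame (ℓ : Level) : Set (lsuc ℓ) where
  infixr 6 _⋓_
  infix  4 _≼_ _≽_ _R°_ _≽∘R°_
  field
    W                        : Set ℓ
    nonempty                 : W
    R                        : Rel W ℓ
    isPartialOrder           : IsPartialOrder _≡_ R
    _⋓_                      : Op₂ (Team W)
    isBoundedJoinSemilattice : IsBoundedJoinSemilattice _≐_ _⋓_ ∅

  _≼_ : Rel (Team W) ℓ
  t ≼ s = (t ⋓ s) ≐ s

  _≽_ : Rel (Team W) ℓ
  t ≽ s = s ≼ t

  _R°_ : Rel (Team W) ℓ
  _R°_ = Lifting R

  _≽∘R°_ : Rel (Team W) (lsuc ℓ)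
  t ≽∘R° s = ∃[ r ] (t ≽ r × r R° s)

  field
    R°-≽  : ∀ t s s′ → t R° s → s ≽ s′ → ∃[ t′ ] (t ≽ t′ × t′ R° s′)
    ≽∘R°⇒ : ∀ t s → t ≽∘R° s → R [ t ] ≽ s
    R[]-⋓ : ∀ t s → (R [ t ] ⋓ R [ s ]) ≐ R [ t ⋓ s ]

Distributive : {ℓ : Level} → Frame ℓ → Set (lsuc ℓ)
Distributive F = ∀ t r s → t ≼ r ⋓ s →
  ∃[ r′ ] ∃[ s′ ] (r′ ≼ r × s′ ≼ s × t ≐ (r′ ⋓ s′))
  where open Frame F

record Model {a ℓ : Level} (Var : Set a) (F : Frame ℓ) : Set (a ⊔ lsuc ℓ) where
  open Frame F
  field
    V          : Var → Team W
    persistent : ∀ p w v → w ∈ V p → R w v → v ∈ V p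

module _ {a ℓ : Level} {Var : Set a} {F : Frame ℓ} where
  open Frame F
  infix 4 _,_⊨_

  _,_⊨_ : Model Var F → Team W → Formula Var → Set (lsuc ℓ)
  M , t ⊨ var p   = Lift (lsuc ℓ) (t ≼ Model.V M p)
  M , t ⊨ ⊥       = Lift (lsuc ℓ) (t ≐ ∅ {ℓ = ℓ})
  M , t ⊨ (φ ∧ ψ) = (M , t ⊨ φ) × (M , t ⊨ ψ)
  M , t ⊨ (φ ∨ ψ) = ∃[ s ] ∃[ r ] (t ≼ s ⋓ r × (M , s ⊨ φ) × (M , r ⊨ ψ))
  M , t ⊨ (φ ⊻ ψ) = (M , t ⊨ φ) ⊎ (M , t ⊨ ψ)
  M , t ⊨ (φ ⇒ ψ) = ∀ s → t ≽∘R° s → M , s ⊨ φ → M , s ⊨ ψ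

Valid : {a ℓ : Level} {Var : Set a} → Frame ℓ → Formula Var → Set (a ⊔ lsuc ℓ)
Valid {Var = Var} F φ = ∀ (M : Model Var F) t → M , t ⊨ φ

{-# OPTIONS --safe #-}
module Submission where

open import Level using (Level; lift; lower)
open import Data.Product.Base using (_×_; _,_; proj₁; proj₂)
open import Data.Sum.Base using (inj₁; inj₂)
open import Algebra.Bundles using (IdempotentCommutativeMonoid)
import Algebra.Properties.CommutativeSemigroup as CommutativeSemigroupProperties
open import Relation.Binary.Structures using (IsPartialOrder)
open import Relation.Unary using (_≐_)
open import Relation.Unary.Polymorphic using (∅)
import Relation.Binary.Reasoning.Setoid as SetoidReasoning
open import Defs

-- Write Q for ≽∘R°. By (a), Q is a preorder containing ≽, and by (b) and (c)
-- every formula is preserved along Q; in particular truth is downward closed.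
-- By distributivity, a Q-successor of t ⋓ s splits as the join of a Q-successor
-- of t and one of s, so the truth of a standard formula is closed under ⋓.
-- Both validities follow by splitting a team that supports a local disjunction.

module FrameProperties {ℓ : Level} (F : Frame ℓ) where
  open Frame F
  open IsPartialOrder isPartialOrder using () renaming (refl to R-refl; trans to R-trans)

  ⋓-idempotentCommutativeMonoid : IdempotentCommutativeMonoid _ _
  ⋓-idempotentCommutativeMonoid = record { isIdempotentCommutativeMonoid = isBoundedJoinSemilattice }

  open IdempotentCommutativeMonoid ⋓-idempotentCommutativeMonoid public
    using (setoid; assoc; comm; idem; identityʳ; ∙-cong; ∙-congˡ; ∙-congʳ; commutativeSemigroup)
    renaming (sym to ≐-sym; trans to ≐-trans)
  open CommutativeSemigroupProperties commutativeSemigroup using (interchange)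
  open SetoidReasoning setoid

  ≼-reflexive : ∀ {t s} → t ≐ s → t ≼ s
  ≼-reflexive {t} {s} t≐s = ≐-trans (∙-congʳ t≐s) (idem s)

  ≼-refl : ∀ {t} → t ≼ t
  ≼-refl {t} = idem t

  ≼-trans : ∀ {t s r} → t ≼ s → s ≼ r → t ≼ r
  ≼-trans {t} {s} {r} t≼s s≼r = begin
    t ⋓ r        ≈⟨ ∙-congˡ {t} s≼r ⟨
    t ⋓ (s ⋓ r)  ≈⟨ assoc t s r ⟨
    (t ⋓ s) ⋓ r  ≈⟨ ∙-congʳ t≼s ⟩
    s ⋓ r        ≈⟨ s≼r ⟩
    r            ∎

  ⋓-mono-≼ : ∀ {t t′ s s′} → t ≼ t′ → s ≼ s′ → t ⋓ s ≼ t′ ⋓ s′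
  ⋓-mono-≼ {t} {t′} {s} {s′} t≼t′ s≼s′ =
    ≐-trans (interchange t s t′ s′) (∙-cong t≼t′ s≼s′)

  ⋓-lub : ∀ {t s r} → t ≼ r → s ≼ r → t ⋓ s ≼ r
  ⋓-lub t≼r s≼r = ≼-trans (⋓-mono-≼ t≼r s≼r) (≼-reflexive (idem _))

  t≼t⋓s : ∀ t s → t ≼ t ⋓ s
  t≼t⋓s t s = ≐-trans (≐-sym (assoc t t s)) (∙-congʳ (idem t))

  s≼t⋓s : ∀ t s → s ≼ t ⋓ s
  s≼t⋓s t s = ≼-trans (t≼t⋓s s t) (≼-reflexive (comm s t))

  R[]-cong : ∀ {t s} → t ≐ s → R [ t ] ≐ R [ s ]
  R[]-cong (t⊆s , s⊆t) =
    (λ (w , w∈t , wRv) → w , t⊆s w∈t , wRv) ,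
    (λ (w , w∈s , wRv) → w , s⊆t w∈s , wRv)

  -- By (c), `R [_]` preserves joins, and a join-preserving map is monotone.
  R[]-mono-≼ : ∀ {t s} → t ≼ s → R [ t ] ≼ R [ s ]
  R[]-mono-≼ {t} {s} t≼s = ≐-trans (R[]-⋓ t s) (R[]-cong t≼s)

  R°-refl : ∀ {t} → t R° t
  R°-refl = (λ w w∈t → w , w∈t , R-refl) , (λ w w∈t → w , w∈t , R-refl)

  R°-trans : ∀ {t s r} → t R° s → s R° r → t R° r
  R°-trans (ts , st) (sr , rs) =
    (λ w w∈t → let v , v∈s , wRv = ts w w∈t ; u , u∈r , vRu = sr v v∈s in u , u∈r , R-trans wRv vRu) ,
    (λ u u∈r → let v , v∈s , vRu = rs u u∈r ; w , w∈t , wRv = st v v∈s in w , w∈t , R-trans wRv vRu)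

  R°-R[] : ∀ t → t R° (R [ t ])
  R°-R[] t = (λ w w∈t → w , (w , w∈t , R-refl) , R-refl) , (λ v v∈R[t] → v∈R[t])

  ≽⇒≽∘R° : ∀ {t s} → t ≽ s → t ≽∘R° s
  ≽⇒≽∘R° {s = s} t≽s = s , t≽s , R°-refl

  R°⇒≽∘R° : ∀ {t s} → t R° s → t ≽∘R° s
  R°⇒≽∘R° {t} tR°s = t , ≼-refl , tR°s

  ≽∘R°-trans : ∀ {t s r} → t ≽∘R° s → s ≽∘R° r → t ≽∘R° r
  ≽∘R°-trans (t′ , t≽t′ , t′R°s) (s′ , s≽s′ , s′R°r) =
    -- Condition (a) swaps the two inner steps: `t′ R° s ≽ s′` becomes `t′ ≽ t″ R° s′`.
    let t″ , t′≽t″ , t″R°s′ = R°-≽ _ _ _ t′R°s s≽s′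
    in t″ , ≼-trans t′≽t″ t≽t′ , R°-trans t″R°s′ s′R°r

  -- Converse of (b): the `≽∘R°`-successors of `t` are exactly the teams below `R [ t ]`, so
  -- distributivity, a condition on `≼`, can split successors.
  R[]-≽⇒≽∘R° : ∀ {t s} → R [ t ] ≽ s → t ≽∘R° s
  R[]-≽⇒≽∘R° {t} R[t]≽s = ≽∘R°-trans (R°⇒≽∘R° (R°-R[] t)) (≽⇒≽∘R° R[t]≽s)

  ≽∘R°-∅ : ∀ {t s} → t ≐ ∅ → t ≽∘R° s → s ≐ ∅
  ≽∘R°-∅ t≐∅ (r , r≼t , rR°s) =
    (λ v∈s → let _ , w∈r , _ = proj₂ rR°s _ v∈s in proj₁ r≐∅ w∈r) , (λ ())
    where
    r≐∅ : r ≐ ∅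
    r≐∅ = ≐-trans (≐-sym (identityʳ r)) (≼-trans r≼t (≼-reflexive t≐∅))

  module _ {a : Level} {Var : Set a} (M : Model Var F) where
    open Model M

    R[V]≐V : ∀ p → R [ V p ] ≐ V p
    R[V]≐V p = (λ (w , w∈V , wRv) → persistent p w _ w∈V wRv) , (λ {v} v∈V → v , v∈V , R-refl)

    ⊨-≽∘R° : ∀ φ {t s} → t ≽∘R° s → M , t ⊨ φ → M , s ⊨ φ
    ⊨-≽∘R° (var p) tQs (lift t≼V) =
      lift (≼-trans (≽∘R°⇒ _ _ tQs) (≼-trans (R[]-mono-≼ t≼V) (≼-reflexive (R[V]≐V p))))
    ⊨-≽∘R° ⊥ tQs (lift t≐∅) = lift (≽∘R°-∅ t≐∅ tQs)
    ⊨-≽∘R° (φ ∧ ψ) tQs (⊨φ , ⊨ψ) = ⊨-≽∘R° φ tQs ⊨φ , ⊨-≽∘R° ψ tQs ⊨ψ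
    ⊨-≽∘R° (φ ∨ ψ) tQs (r , r′ , t≼r⋓r′ , ⊨φ , ⊨ψ) =
      -- The images cover `s`: by (b) and (c), `s ≼ R [ t ] ≼ R [ r ⋓ r′ ] ≐ R [ r ] ⋓ R [ r′ ]`.
      R [ r ] , R [ r′ ] ,
      ≼-trans (≽∘R°⇒ _ _ tQs)
        (≼-trans (R[]-mono-≼ t≼r⋓r′) (≼-reflexive (≐-sym (R[]-⋓ r r′)))) ,
      ⊨-≽∘R° φ (R°⇒≽∘R° (R°-R[] r)) ⊨φ ,
      ⊨-≽∘R° ψ (R°⇒≽∘R° (R°-R[] r′)) ⊨ψ
    ⊨-≽∘R° (φ ⊻ ψ) tQs (inj₁ ⊨φ) = inj₁ (⊨-≽∘R° φ tQs ⊨φ)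
    ⊨-≽∘R° (φ ⊻ ψ) tQs (inj₂ ⊨ψ) = inj₂ (⊨-≽∘R° ψ tQs ⊨ψ)
    ⊨-≽∘R° (φ ⇒ ψ) tQs ⊨φ⇒ψ r sQr = ⊨φ⇒ψ r (≽∘R°-trans tQs sQr)

    -- Since `≐` implies `≼`, this also transports truth between extensionally equal teams.
    ⊨-≽ : ∀ φ {t s} → t ≽ s → M , t ⊨ φ → M , s ⊨ φ
    ⊨-≽ φ t≽s = ⊨-≽∘R° φ (≽⇒≽∘R° t≽s)

    module _ (distributive : Distributive F) where

      -- Induction on standardness, which rules out `⊻`, where the two teams could support different
      -- disjuncts. For an implication, the antecedent passes to the two pieces by downward closure,
      -- and the induction hypothesis joins the consequents.
      ⊨-⋓ : ∀ {α} → Standard α → ∀ {t s} → M , t ⊨ α → M , s ⊨ α → M , t ⋓ s ⊨ α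
      ⊨-⋓ (var p) (lift t≼V) (lift s≼V) = lift (⋓-lub t≼V s≼V)
      ⊨-⋓ ⊥ (lift t≐∅) (lift s≐∅) = lift (≐-trans (∙-cong t≐∅ s≐∅) (idem ∅))
      ⊨-⋓ (α ∧ β) (t⊨α , t⊨β) (s⊨α , s⊨β) = ⊨-⋓ α t⊨α s⊨α , ⊨-⋓ β t⊨β s⊨β
      ⊨-⋓ (α ∨ β) (t₁ , t₂ , t≼ , t₁⊨α , t₂⊨β) (s₁ , s₂ , s≼ , s₁⊨α , s₂⊨β) =
        t₁ ⋓ s₁ , t₂ ⋓ s₂ ,
        ≼-trans (⋓-mono-≼ t≼ s≼) (≼-reflexive (interchange t₁ t₂ s₁ s₂)) ,
        ⊨-⋓ α t₁⊨α s₁⊨α , ⊨-⋓ β t₂⊨β s₂⊨β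
      ⊨-⋓ {φ ⇒ ψ} (_ ⇒ β) {t} {s} t⊨φ⇒ψ s⊨φ⇒ψ u t⋓sQu u⊨φ =
        let u₁ , u₂ , u₁≼R[t] , u₂≼R[s] , u≐u₁⋓u₂ = distributive u (R [ t ]) (R [ s ])
              (≼-trans (≽∘R°⇒ _ _ t⋓sQu) (≼-reflexive (≐-sym (R[]-⋓ t s))))
            u₁⋓u₂⊨φ = ⊨-≽ φ (≼-reflexive (≐-sym u≐u₁⋓u₂)) u⊨φ
        in ⊨-≽ ψ (≼-reflexive u≐u₁⋓u₂) (⊨-⋓ β
             (t⊨φ⇒ψ u₁ (R[]-≽⇒≽∘R° u₁≼R[t]) (⊨-≽ φ (t≼t⋓s u₁ u₂) u₁⋓u₂⊨φ))
             (s⊨φ⇒ψ u₂ (R[]-≽⇒≽∘R° u₂≼R[s]) (⊨-≽ φ (s≼t⋓s u₁ u₂) u₁⋓u₂⊨φ)))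

      ⊨-∨-elim : ∀ {α} → Standard α → ∀ φ ψ {t} →
        M , t ⊨ (φ ⇒ α) → M , t ⊨ (ψ ⇒ α) → M , t ⊨ (φ ∨ ψ) → M , t ⊨ α
      ⊨-∨-elim {α} std φ ψ {t} ⊨φ⇒α ⊨ψ⇒α (r , s , t≼r⋓s , r⊨φ , s⊨ψ) =
        -- The cover of `t` is refined to an exact decomposition: the pieces then lie below `t`,
        -- where both implications apply.
        let r′ , s′ , r′≼r , s′≼s , t≐r′⋓s′ = distributive t r s t≼r⋓s
            r′⋓s′≼t = ≼-reflexive (≐-sym t≐r′⋓s′)
        in ⊨-≽ α (≼-reflexive t≐r′⋓s′) (⊨-⋓ std
             (⊨φ⇒α r′ (≽⇒≽∘R° (≼-trans (t≼t⋓s r′ s′) r′⋓s′≼t)) (⊨-≽ φ r′≼r r⊨φ))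
             (⊨ψ⇒α s′ (≽⇒≽∘R° (≼-trans (s≼t⋓s r′ s′) r′⋓s′≼t)) (⊨-≽ ψ s′≼s s⊨ψ)))

corollary4p28 : {a ℓ : Level} {Var : Set a} (α φ ψ : Formula Var) → Standard α →
    (F : Frame ℓ) → Distributive F →
    Valid F (α ∨ α ⇒ α) × Valid F ((φ ⇒ α) ⇒ ((ψ ⇒ α) ⇒ (φ ∨ ψ ⇒ α)))
corollary4p28 α φ ψ std F distributive =
  -- The case where both disjuncts are `α`, with the trivial implication `α ⇒ α` as both premises.
  (λ M _ _ _ → ⊨-∨-elim M distributive std α α (λ _ _ ⊨α → ⊨α) (λ _ _ ⊨α → ⊨α)) ,
  (λ M _ _ _ ⊨φ⇒α _ t₁Qt₂ ⊨ψ⇒α _ t₂Qt₃ → ⊨-∨-elim M distributive std φ ψ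
    -- The premises hold at earlier teams and are carried along `≽∘R°` to the team supporting
    -- `φ ∨ ψ`.
    (⊨-≽∘R° M (φ ⇒ α) (≽∘R°-trans t₁Qt₂ t₂Qt₃) ⊨φ⇒α)
    (⊨-≽∘R° M (ψ ⇒ α) t₂Qt₃ ⊨ψ⇒α))
  where open FrameProperties F
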